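{- For all integers $n\ge0$, \[ E_n(-q,q) = \frac{1}{(1-q)^{2n}} \sum_{k=0}^n \left( \binom{2n}{n-k} - \binom{2n}{n-k-1} \right) (-1)^k\,\frac{q^{k^2}+q^{(k+1)^2}}{1+q}. \]
   Context: Here $[n]_q=(1-q^n)/(1-q)$ and $[n]_{t,q}=(1-tq^n)/(1-q)$. The $(t,q)$-Euler numbers $E_n(t,q)$, $n\ge 0$, are defined by the continued fraction expansion (as a formal power series in $x$) \[ \sum_{n\geq0} E_{n}(t,q) x^n = \cfrac{1}{1- \cfrac{[1]_q[1]_{t,q}\, x}{1- \cfrac{[2]_q[2]_{t,q}\, x}{1-\cdots}}}, \] where the $m$-th partial coefficient is $[m]_q[m]_{t,q}$. $E_n(-q,q)$ is the value at $t=-q$. Binomial coefficients $\binom{a}{b}$ with $b<0$ are $0$. -}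

module Defs where

open import Algebra.Bundles using (CommutativeRing)
import Algebra.Definitions
import Algebra.Properties.Semiring.Exp
import Algebra.Properties.Semiring.Mult
import Algebra.Properties.Semiring.Sum
open import Data.Fin.Base using (Fin; zero; suc; toℕ)
open import Data.Integer.Base as ℤ using (ℤ; -[1+_])
open import Data.Nat.Base as ℕ using (ℕ; zero; suc; _∸_; s≤s)
open import Data.Nat.Combinatorics using (_C_)
open import Data.Nat.Properties using (≤-refl; ≤-trans; m≤n⇒m≤1+n; ≤-pred)
open import Data.Fin.Properties using (toℕ<n)
open import Data.Product.Base using (proj₁)
open import Data.Vec.Base using (Vec; []; _∷_; head; lookup)
open import Function.Base using (_∘_)
open import Level using (_⊔_)
open import Relation.Binary.PropositionalEquality.Core as ≡ using (_≡_)

-- The lower index is an integer because binomials such as (2n choose n-k-1)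
-- with k = n must vanish, which truncated subtraction would not give.
binom : ℕ → ℤ → ℕ
binom a (ℤ.+ b)  = a C b
binom a -[1+ _ ] = 0

-- Taking q in an arbitrary commutative ring, with the occurring denominators
-- invertible, includes the case of an indeterminate q in ℚ(q).
module Euler {c ℓ} (R : CommutativeRing c ℓ) where

  open CommutativeRing R hiding (zero)
  open Algebra.Properties.Semiring.Sum semiring using (sum⁺-syntax; sum-cong-≋)
  open Algebra.Properties.Semiring.Exp semiring public using (_^_)
  open Algebra.Properties.Semiring.Mult semiring public using (_×_)
  open import Relation.Binary.Reasoning.Setoid setoid

  Invertible : Carrier → Set (c ⊔ ℓ)
  Invertible = Algebra.Definitions.Invertible _≈_ 1# _*_

  infixl 7 _/_
  _/_ : (x y : Carrier) → ⦃ Invertible y ⦄ → Carrier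
  (x / y) ⦃ y⁻¹ ⦄ = x * proj₁ y⁻¹

  -- Both ends k = 0 and k = n are included.
  ∑₀ : ℕ → (ℕ → Carrier) → Carrier
  ∑₀ n f = ∑[ k ≤ n ] f (toℕ k)

  -- Formal power series in x, given by their coefficients.
  Series : Set c
  Series = ℕ → Carrier

  one : Series
  one zero    = 1#
  one (suc _) = 0#

  _⊛_ : Series → Series → Series
  (F ⊛ G) n = ∑₀ n λ i → F i * G (n ∸ i)

  -- The reciprocal of a series F with constant coefficient 1, from
  -- H₀ = 1 and Hₙ₊₁ = - Σ_{0≤i≤n} Fᵢ₊₁ Hₙ₋ᵢ.  The vector recipCoeffs F n
  -- lists Hₙ, …, H₀ in this (decreasing) order.
  recipCoeffs : Series → (n : ℕ) → Vec Carrier (suc n)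
  recipCoeffs F zero    = 1# ∷ []
  recipCoeffs F (suc n) =
    - (∑[ i ≤ n ] (F (suc (toℕ i)) * lookup (recipCoeffs F n) i)) ∷ recipCoeffs F n

  recip : Series → Series
  recip F n = head (recipCoeffs F n)

  1-_x·_ : Carrier → Series → Series
  (1- a x· F) zero    = 1#
  (1- a x· F) (suc n) = - (a * F n)

  -- The finite continued fraction
  --   1 / (1 - a₀ x / (1 - a₁ x / ( … / (1 - a_{N-1} x)))).
  convergent : (ℕ → Carrier) → ℕ → Series
  convergent a zero    = one
  convergent a (suc N) = recip (1- a 0 x· convergent (a ∘ suc) N)

  -- The infinite continued fraction is the x-adic limit of its convergents:
  -- the coefficient of xⁿ no longer changes from depth n on
  -- (convergent-stable below).
  continuedFraction : (ℕ → Carrier) → Series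
  continuedFraction a n = convergent a n n

  qInt : (q : Carrier) → ⦃ Invertible (1# - q) ⦄ → ℕ → Carrier
  qInt q n = (1# - q ^ n) / (1# - q)

  tqInt : (t q : Carrier) → ⦃ Invertible (1# - q) ⦄ → ℕ → Carrier
  tqInt t q n = (1# - t * q ^ n) / (1# - q)

  -- Sequences are indexed from 0, so the m-th partial coefficient of the
  -- continued fraction (m ≥ 1) sits at index m - 1.
  E : ℕ → (t q : Carrier) → ⦃ Invertible (1# - q) ⦄ → Carrier
  E n t q = continuedFraction (λ i → qInt q (suc i) * tqInt t q (suc i)) n

  lookup-recipCoeffs : ∀ F n (i : Fin (suc n)) →
                       lookup (recipCoeffs F n) i ≡ recip F (n ∸ toℕ i)
  lookup-recipCoeffs F zero    zero    = ≡.refl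
  lookup-recipCoeffs F (suc n) zero    = ≡.refl
  lookup-recipCoeffs F (suc n) (suc i) = lookup-recipCoeffs F n i

  recip-inverse : ∀ F → F 0 ≈ 1# → ∀ n → (F ⊛ recip F) n ≈ one n
  recip-inverse F F₀≈1 zero = begin
    F 0 * 1# + 0#  ≈⟨ +-identityʳ _ ⟩
    F 0 * 1#       ≈⟨ *-identityʳ _ ⟩
    F 0            ≈⟨ F₀≈1 ⟩
    1#             ∎
  recip-inverse F F₀≈1 (suc n) = begin
    F 0 * - S + ∑[ i ≤ n ] (F (suc (toℕ i)) * recip F (n ∸ toℕ i))
      ≈⟨ +-cong (*-congʳ F₀≈1)
                (sum-cong-≋ λ i → *-congˡ {F (suc (toℕ i))} (reflexive (≡.sym (lookup-recipCoeffs F n i)))) ⟩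
    1# * - S + S  ≈⟨ +-congʳ (*-identityˡ _) ⟩
    - S + S       ≈⟨ -‿inverseˡ S ⟩
    0#            ∎
    where
    S : Carrier
    S = ∑[ i ≤ n ] (F (suc (toℕ i)) * lookup (recipCoeffs F n) i)

  recipCoeffs-cong : ∀ F G n → (∀ k → k ℕ.≤ n → F k ≈ G k) →
                     ∀ i → lookup (recipCoeffs F n) i ≈ lookup (recipCoeffs G n) i
  recipCoeffs-cong F G zero    F≈G zero = refl
  recipCoeffs-cong F G (suc n) F≈G zero = -‿cong (sum-cong-≋ λ i →
    *-cong (F≈G (suc (toℕ i)) (toℕ<n i))
           (recipCoeffs-cong F G n (λ k k≤n → F≈G k (m≤n⇒m≤1+n k≤n)) i))
  recipCoeffs-cong F G (suc n) F≈G (suc i) =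
    recipCoeffs-cong F G n (λ k k≤n → F≈G k (m≤n⇒m≤1+n k≤n)) i

  recip-cong : ∀ F G n → (∀ k → k ℕ.≤ n → F k ≈ G k) → recip F n ≈ recip G n
  recip-cong F G n F≈G = begin
    recip F n                       ≡⟨ lookup-recipCoeffs F n zero ⟨
    lookup (recipCoeffs F n) zero   ≈⟨ recipCoeffs-cong F G n F≈G zero ⟩
    lookup (recipCoeffs G n) zero   ≡⟨ lookup-recipCoeffs G n zero ⟩
    recip G n                       ∎

  convergent-stable : ∀ a N M n → n ℕ.≤ N → n ℕ.≤ M → convergent a N n ≈ convergent a M n
  convergent-stable a zero    zero    n    _   _   = refl
  convergent-stable a zero    (suc M) zero _   _   = refl
  convergent-stable a (suc N) zero    zero _   _   = refl
  convergent-stable a (suc N) (suc M) n    n≤N n≤M = recip-cong _ _ n agree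
    where
    agree : ∀ k → k ℕ.≤ n → (1- a 0 x· convergent (a ∘ suc) N) k ≈
                            (1- a 0 x· convergent (a ∘ suc) M) k
    agree zero    _   = refl
    agree (suc k) k<n = -‿cong (*-congˡ (convergent-stable (a ∘ suc) N M k
      (≤-pred (≤-trans k<n n≤N)) (≤-pred (≤-trans k<n n≤M))))

  continuedFraction-unfold : ∀ a n →
    ((1- a 0 x· continuedFraction (a ∘ suc)) ⊛ continuedFraction a) n ≈ one n
  continuedFraction-unfold a n = begin
    (D ⊛ continuedFraction a) n
      ≈⟨ sum-cong-≋ {suc n} (λ i → *-congˡ {D (toℕ i)} (unfold (n ∸ toℕ i))) ⟩
    (D ⊛ recip D) n
      ≈⟨ recip-inverse D refl n ⟩
    one n ∎
    where
    D : Series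
    D = 1- a 0 x· continuedFraction (a ∘ suc)

    agree : ∀ m k → k ℕ.≤ suc m → (1- a 0 x· convergent (a ∘ suc) m) k ≈ D k
    agree m zero    _         = refl
    agree m (suc k) (s≤s k≤m) =
      -‿cong (*-congˡ (convergent-stable (a ∘ suc) m k k k≤m ≤-refl))

    unfold : ∀ m → continuedFraction a m ≈ recip D m
    unfold zero    = refl
    unfold (suc m) = recip-cong _ D (suc m) (agree m)

{-# OPTIONS --safe #-}

-- By Flajolet, (1 - q)²ⁿ E_n(-q, q) is the moment L(x²ⁿ) of the orthogonal polynomials
-- x P_j = P_{j+1} + w_{j-1} P_{j-1} with w_j = (1 - q^(j+1)) (1 + q^(j+2)).
-- Expanding x²ⁿ in the Chebyshev polynomials U_{2k}(x/2) produces the ballot numbers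
-- C(2n, n-k) - C(2n, n-k-1), so it remains to find L(U_{2k}(x/2)).  The coefficient of P_j
-- in U_{j+2i}(x/2) has the closed form
--   (-1)^i q^(i²) [i+j choose i]_{q²} (1 + q^(j+2i+1)) / (1 + q^(j+1)),
-- which follows from the three-term recurrences by q-Pascal; j = 0 gives L(U_{2k}(x/2)).
-- Since 1 + q^(j+1) need not be invertible in R, a division-free form is used.

module Submission where

open import Algebra.Bundles using (CommutativeRing)
import Algebra.Properties.CommutativeSemiring.Exp
import Algebra.Properties.Monoid.Mult
import Algebra.Properties.Ring
import Algebra.Properties.Semiring.Exp
import Algebra.Properties.Semiring.Mult.TCOptimised
import Algebra.Properties.Semiring.Sum
import Algebra.Solver.Ring
open import Algebra.Solver.Ring.AlmostCommutativeRing
  using (fromCommutativeRing; _-Raw-AlmostCommutative⟶_)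
open import Data.Fin.Base using (Fin; toℕ)
open import Data.Fin.Permutation using (reverse)
open import Data.Fin.Properties using (opposite-prop; toℕ≤pred[n])
open import Data.Integer.Base as ℤ using (ℤ; -[1+_])
import Data.Integer.Properties as ℤ
open import Data.Maybe.Base using (Maybe; map)
open import Data.Nat.Base as ℕ using (ℕ; zero; suc; _∸_; s≤s)
open import Data.Nat.Combinatorics using (_C_; nCk≡nC[n∸k]; nCn≡1; nCk+nC[k+1]≡[n+1]C[k+1])
import Data.Nat.Properties as ℕ
open import Data.Nat.Solver using (module +-*-Solver)
open import Data.Product.Base using (_,_; proj₁)
open import Function.Base using (_∘_)
open import Relation.Binary.PropositionalEquality.Core as ≡ using (_≡_)
import Relation.Binary.Reasoning.Setoid
open import Relation.Nullary.Decidable using (dec⇒maybe)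
open import Defs

-- Index arithmetic in the natural numbers

module ℕ-identities where

  open +-*-Solver

  2[1+n]+j≡2n+[2+j] : ∀ n j → 2 ℕ.* suc n ℕ.+ j ≡ 2 ℕ.* n ℕ.+ suc (suc j)
  2[1+n]+j≡2n+[2+j] = solve 2 (λ n j → con 2 :* (con 1 :+ n) :+ j := con 2 :* n :+ (con 2 :+ j)) ≡.refl

  [1+i]²≡i²+[1+2i] : ∀ i → suc i ℕ.^ 2 ≡ i ℕ.^ 2 ℕ.+ suc (i ℕ.+ i)
  [1+i]²≡i²+[1+2i] = solve 1 (λ i → (con 1 :+ i) :^ 2 := i :^ 2 :+ (con 1 :+ (i :+ i))) ≡.refl

open ℕ-identities

-- Integer coefficients for the ring solver

module IntegerCoefficients {c ℓ} (R : CommutativeRing c ℓ) where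

  open CommutativeRing R hiding (zero)
  open Algebra.Properties.Ring ring
  open Algebra.Properties.Semiring.Mult.TCOptimised semiring
    using (1+×; ×-homo-+; ×1-homo-*) renaming (_×_ to _×′_)
  open Relation.Binary.Reasoning.Setoid setoid

  -- The solver has to decide equality of coefficients, which is possible for integers but not in an
  -- arbitrary ring. With the optimised multiplication `⟦ ℤ.+ 1 ⟧` reduces to `1#` itself.
  ⟦_⟧ : ℤ → Carrier
  ⟦ ℤ.+ n ⟧    = n ×′ 1#
  ⟦ -[1+ n ] ⟧ = - (suc n ×′ 1#)

  ⟦⟧-neg : ∀ i → ⟦ ℤ.- i ⟧ ≈ - ⟦ i ⟧
  ⟦⟧-neg (ℤ.+ zero)  = sym -0#≈0#
  ⟦⟧-neg (ℤ.+ suc n) = refl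
  ⟦⟧-neg -[1+ n ]    = sym (-‿involutive _)

  [x+y]-[x+z]≈y-z : ∀ x y z → (x + y) - (x + z) ≈ y - z
  [x+y]-[x+z]≈y-z x y z = begin
    (x + y) - (x + z)    ≈⟨ +-cong (+-comm x y) (sym (-‿+-comm x z)) ⟩
    (y + x) + (- x - z)  ≈⟨ +-assoc y x _ ⟩
    y + (x + (- x - z))  ≈⟨ +-congˡ (+-assoc x (- x) (- z)) ⟨
    y + ((x - x) - z)    ≈⟨ +-congˡ (+-congʳ (-‿inverseʳ x)) ⟩
    y + (0# - z)         ≈⟨ +-congˡ (+-identityˡ (- z)) ⟩
    y - z                ∎

  ⟦⟧-⊖ : ∀ m n → ⟦ m ℤ.⊖ n ⟧ ≈ m ×′ 1# - n ×′ 1#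
  ⟦⟧-⊖ zero    zero    = sym (-‿inverseʳ 0#)
  ⟦⟧-⊖ zero    (suc n) = sym (+-identityˡ _)
  ⟦⟧-⊖ (suc m) zero    = sym (trans (+-congˡ -0#≈0#) (+-identityʳ _))
  ⟦⟧-⊖ (suc m) (suc n) = begin
    ⟦ suc m ℤ.⊖ suc n ⟧                ≡⟨ ≡.cong ⟦_⟧ (ℤ.[1+m]⊖[1+n]≡m⊖n m n) ⟩
    ⟦ m ℤ.⊖ n ⟧                        ≈⟨ ⟦⟧-⊖ m n ⟩
    m ×′ 1# - n ×′ 1#                  ≈⟨ [x+y]-[x+z]≈y-z 1# _ _ ⟨
    (1# + m ×′ 1#) - (1# + n ×′ 1#)    ≈⟨ +-cong (1+× m 1#) (-‿cong (1+× n 1#)) ⟨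
    suc m ×′ 1# - suc n ×′ 1#          ∎

  ⟦⟧-+ : ∀ i j → ⟦ i ℤ.+ j ⟧ ≈ ⟦ i ⟧ + ⟦ j ⟧
  ⟦⟧-+ (ℤ.+ m)  (ℤ.+ n)  = ×-homo-+ 1# m n
  ⟦⟧-+ (ℤ.+ m)  -[1+ n ] = ⟦⟧-⊖ m (suc n)
  ⟦⟧-+ -[1+ m ] (ℤ.+ n)  = trans (⟦⟧-⊖ n (suc m)) (+-comm _ _)
  ⟦⟧-+ -[1+ m ] -[1+ n ] = begin
    - (suc (suc (m ℕ.+ n)) ×′ 1#)        ≡⟨ ≡.cong (λ k → - (suc k ×′ 1#)) (≡.sym (ℕ.+-suc m n)) ⟩
    - ((suc m ℕ.+ suc n) ×′ 1#)          ≈⟨ -‿cong (×-homo-+ 1# (suc m) (suc n)) ⟩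
    - (suc m ×′ 1# + suc n ×′ 1#)        ≈⟨ -‿+-comm _ _ ⟨
    - (suc m ×′ 1#) - suc n ×′ 1#        ∎

  ⟦⟧-pos-* : ∀ m j → ⟦ ℤ.+ m ℤ.* j ⟧ ≈ ⟦ ℤ.+ m ⟧ * ⟦ j ⟧
  ⟦⟧-pos-* m (ℤ.+ n)  = begin
    ⟦ ℤ.+ m ℤ.* ℤ.+ n ⟧  ≡⟨ ≡.cong ⟦_⟧ (ℤ.pos-* m n) ⟨
    (m ℕ.* n) ×′ 1#      ≈⟨ ×1-homo-* m n ⟩
    m ×′ 1# * n ×′ 1#    ∎
  ⟦⟧-pos-* m -[1+ n ] = begin
    ⟦ ℤ.+ m ℤ.* -[1+ n ] ⟧          ≡⟨ ≡.cong ⟦_⟧ (ℤ.neg-distribʳ-* (ℤ.+ m) (ℤ.+ suc n)) ⟨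
    ⟦ ℤ.- (ℤ.+ m ℤ.* ℤ.+ suc n) ⟧   ≈⟨ ⟦⟧-neg (ℤ.+ m ℤ.* ℤ.+ suc n) ⟩
    - ⟦ ℤ.+ m ℤ.* ℤ.+ suc n ⟧       ≈⟨ -‿cong (⟦⟧-pos-* m (ℤ.+ suc n)) ⟩
    - (m ×′ 1# * suc n ×′ 1#)       ≈⟨ -‿distribʳ-* _ _ ⟩
    m ×′ 1# * - (suc n ×′ 1#)       ∎

  ⟦⟧-* : ∀ i j → ⟦ i ℤ.* j ⟧ ≈ ⟦ i ⟧ * ⟦ j ⟧
  ⟦⟧-* (ℤ.+ m)  j = ⟦⟧-pos-* m j
  ⟦⟧-* -[1+ m ] j = begin
    ⟦ -[1+ m ] ℤ.* j ⟧          ≡⟨ ≡.cong ⟦_⟧ (ℤ.neg-distribˡ-* (ℤ.+ suc m) j) ⟨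
    ⟦ ℤ.- (ℤ.+ suc m ℤ.* j) ⟧   ≈⟨ ⟦⟧-neg (ℤ.+ suc m ℤ.* j) ⟩
    - ⟦ ℤ.+ suc m ℤ.* j ⟧       ≈⟨ -‿cong (⟦⟧-pos-* (suc m) j) ⟩
    - (suc m ×′ 1# * ⟦ j ⟧)     ≈⟨ -‿distribˡ-* _ _ ⟩
    - (suc m ×′ 1#) * ⟦ j ⟧     ∎

  morphism : ℤ.+-*-rawRing -Raw-AlmostCommutative⟶ fromCommutativeRing R
  morphism = record
    { ⟦_⟧    = ⟦_⟧
    ; +-homo = ⟦⟧-+
    ; *-homo = ⟦⟧-*
    ; -‿homo = ⟦⟧-neg
    ; 0-homo = refl
    ; 1-homo = refl
    }

  _≟_ : ∀ i j → Maybe (⟦ i ⟧ ≈ ⟦ j ⟧)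
  i ≟ j = map (λ i≡j → reflexive (≡.cong ⟦_⟧ i≡j)) (dec⇒maybe (i ℤ.≟ j))

  open Algebra.Solver.Ring ℤ.+-*-rawRing (fromCommutativeRing R) morphism _≟_ public
    using (solve; _:=_; _:+_; _:*_; _:-_; :-_; con; Polynomial)

  :1 : ∀ {n} → Polynomial n
  :1 = con (ℤ.+ 1)

-- Weighted lattice paths and continued fractions

module Paths {c ℓ} (R : CommutativeRing c ℓ) where

  open CommutativeRing R hiding (zero)
  open Algebra.Properties.Ring ring
  open Algebra.Properties.Semiring.Sum semiring
    using (sum-cong-≋; *-distribˡ-sum; ∑-permute)
  open Algebra.Properties.Monoid.Mult +-monoid using (×-congˡ; ×-homo-+)
  open Relation.Binary.Reasoning.Setoid setoid
  open Euler R
  open IntegerCoefficients R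

  -- Coefficient n is the total weight of the lattice paths with 2n + j steps
  -- from height 0 to height j that stay nonnegative, where a down step
  -- to height i has weight a i.
  paths : (ℕ → Carrier) → ℕ → Series
  paths a j       zero    = 1#
  paths a zero    (suc n) = a 0 * paths a 1 n
  paths a (suc j) (suc n) = paths a j (suc n) + a (suc j) * paths a (suc (suc j)) n

  -- A path of 2n + j steps from height 0 to height j has exactly n down steps, and each contributes
  -- one factor `s`.
  paths-scale : ∀ a b s → (∀ i → b i ≈ s * a i) →
                ∀ j n → paths b j n ≈ s ^ n * paths a j n
  paths-scale a b s b≈sa j       zero    = sym (*-identityˡ 1#)
  paths-scale a b s b≈sa zero    (suc n) = begin
    b 0 * paths b 1 n
      ≈⟨ *-cong (b≈sa 0) (paths-scale a b s b≈sa 1 n) ⟩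
    (s * a 0) * (s ^ n * paths a 1 n)
      ≈⟨ solve 4 (λ s x t p → (s :* x) :* (t :* p) := (s :* t) :* (x :* p)) refl s (a 0) (s ^ n) (paths a 1 n) ⟩
    (s * s ^ n) * (a 0 * paths a 1 n) ∎
  paths-scale a b s b≈sa (suc j) (suc n) = begin
    paths b j (suc n) + b (suc j) * paths b (suc (suc j)) n
      ≈⟨ +-cong (paths-scale a b s b≈sa j (suc n))
                (*-cong (b≈sa (suc j)) (paths-scale a b s b≈sa (suc (suc j)) n)) ⟩
    s * s ^ n * paths a j (suc n) + (s * a (suc j)) * (s ^ n * paths a (suc (suc j)) n)
      ≈⟨ solve 5 (λ s x t p p′ → s :* t :* p′ :+ (s :* x) :* (t :* p) := s :* t :* (p′ :+ x :* p))
           refl s (a (suc j)) (s ^ n) (paths a (suc (suc j)) n) (paths a j (suc n)) ⟩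
    s * s ^ n * (paths a j (suc n) + a (suc j) * paths a (suc (suc j)) n) ∎

  ⊛-cong : ∀ {F F′ G G′} n → (∀ i → F i ≈ F′ i) → (∀ i → G i ≈ G′ i) →
           (F ⊛ G) n ≈ (F′ ⊛ G′) n
  ⊛-cong n F≈F′ G≈G′ = sum-cong-≋ {suc n} λ i → *-cong (F≈F′ (toℕ i)) (G≈G′ (n ∸ toℕ i))

  ⊛-scaleˡ : ∀ s F G n → ((λ i → s * F i) ⊛ G) n ≈ s * (F ⊛ G) n
  ⊛-scaleˡ s F G n = trans
    (sum-cong-≋ {suc n} λ i → *-assoc s (F (toℕ i)) (G (n ∸ toℕ i)))
    (sym (*-distribˡ-sum s λ (i : Fin (suc n)) → F (toℕ i) * G (n ∸ toℕ i)))

  ⊛-distribʳ : ∀ F F′ G n → ((λ i → F i + F′ i) ⊛ G) n ≈ (F ⊛ G) n + (F′ ⊛ G) n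
  ⊛-distribʳ F F′ G zero    =
    solve 3 (λ x x′ y → (x :+ x′) :* y :+ con (ℤ.+ 0) := (x :* y :+ con (ℤ.+ 0)) :+ (x′ :* y :+ con (ℤ.+ 0)))
      refl (F 0) (F′ 0) (G 0)
  ⊛-distribʳ F F′ G (suc n) = trans (+-congˡ (⊛-distribʳ (F ∘ suc) (F′ ∘ suc) G n))
    (solve 5 (λ x x′ y s s′ → (x :+ x′) :* y :+ (s :+ s′) := (x :* y :+ s) :+ (x′ :* y :+ s′))
      refl (F 0) (F′ 0) (G (suc n)) (((F ∘ suc) ⊛ G) n) (((F′ ∘ suc) ⊛ G) n))

  ⊛-reverse : ∀ F G n → (F ⊛ G) n ≈ ∑₀ n λ k → F (n ∸ k) * G k
  ⊛-reverse F G n = trans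
    (∑-permute (λ i → F (toℕ i) * G (n ∸ toℕ i)) (reverse {suc n}))
    (sum-cong-≋ {suc n} λ i → reflexive (≡.cong₂ (λ k l → F k * G l)
      (opposite-prop i)
      (≡.trans (≡.cong (n ∸_) (opposite-prop i)) (ℕ.m∸[m∸n]≡n (toℕ≤pred[n] i)))))

  -- A path ending at height j + 1 splits at its last step from height 0 to height 1.
  paths-split : ∀ a j n → paths a (suc j) n ≈ (paths (a ∘ suc) j ⊛ paths a 0) n
  paths-split a j       zero    = sym (trans (+-identityʳ _) (*-identityˡ 1#))
  paths-split a zero    (suc n) = +-cong (sym (*-identityˡ _)) (begin
    a 1 * paths a 2 n
      ≈⟨ *-congˡ (paths-split a 1 n) ⟩
    a 1 * (paths (a ∘ suc) 1 ⊛ paths a 0) n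
      ≈⟨ ⊛-scaleˡ (a 1) (paths (a ∘ suc) 1) (paths a 0) n ⟨
    ((λ i → a 1 * paths (a ∘ suc) 1 i) ⊛ paths a 0) n ∎)
  paths-split a (suc j) (suc n) = begin
    paths a (suc j) (suc n) + a (suc (suc j)) * paths a (suc (suc (suc j))) n
      ≈⟨ +-cong (paths-split a j (suc n)) (*-congˡ (paths-split a (suc (suc j)) n)) ⟩
    -- The leading summand is kept apart: `P′ j` and `P′ (suc j)` share the constant coefficient
    -- `1#`, and only the later coefficients obey the path recurrence.
    (1# * P (suc n) + ((P′ j ∘ suc) ⊛ P) n) + a (suc (suc j)) * (P′ (suc (suc j)) ⊛ P) n
      ≈⟨ +-assoc _ _ _ ⟩
    1# * P (suc n) + (((P′ j ∘ suc) ⊛ P) n + a (suc (suc j)) * (P′ (suc (suc j)) ⊛ P) n)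
      ≈⟨ +-congˡ (+-congˡ (⊛-scaleˡ (a (suc (suc j))) (P′ (suc (suc j))) P n)) ⟨
    1# * P (suc n) + (((P′ j ∘ suc) ⊛ P) n + ((λ i → a (suc (suc j)) * P′ (suc (suc j)) i) ⊛ P) n)
      ≈⟨ +-congˡ (⊛-distribʳ (P′ j ∘ suc) (λ i → a (suc (suc j)) * P′ (suc (suc j)) i) P n) ⟨
    1# * P (suc n) + ((P′ (suc j) ∘ suc) ⊛ P) n ∎
    where
    P = paths a 0
    P′ = paths (a ∘ suc)

  -- Compares coefficients of x^(n+1) in (1 - a₀ x F′) F = 1, where F′ is the continued fraction of
  -- the shifted sequence.
  continuedFraction-suc : ∀ a n → continuedFraction a (suc n) ≈
                          a 0 * (continuedFraction (a ∘ suc) ⊛ continuedFraction a) n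
  continuedFraction-suc a n = begin
    F (suc n)
      ≈⟨ solve 2 (λ x y → x := (:1 :* x :+ (:- y)) :+ y) refl (F (suc n)) (a 0 * (F′ ⊛ F) n) ⟩
    (1# * F (suc n) - a 0 * (F′ ⊛ F) n) + a 0 * (F′ ⊛ F) n
      ≈⟨ +-congʳ (+-congˡ (trans (-‿distribˡ-* _ _) (sym (⊛-scaleˡ (- a 0) F′ F n)))) ⟩
    (1# * F (suc n) + ((λ i → - a 0 * F′ i) ⊛ F) n) + a 0 * (F′ ⊛ F) n
      ≈⟨ +-congʳ (+-congˡ (⊛-cong {G = F} n (λ i → -‿distribˡ-* (a 0) (F′ i)) (λ _ → refl))) ⟨
    (1# * F (suc n) + ((λ i → - (a 0 * F′ i)) ⊛ F) n) + a 0 * (F′ ⊛ F) n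
      ≈⟨ +-congʳ (continuedFraction-unfold a (suc n)) ⟩
    0# + a 0 * (F′ ⊛ F) n
      ≈⟨ +-identityˡ _ ⟩
    a 0 * (F′ ⊛ F) n ∎
    where
    F = continuedFraction a
    F′ = continuedFraction (a ∘ suc)

  -- Flajolet's theorem. Both sides start with 1 and satisfy the same convolution recurrence; for
  -- paths it comes from `paths-split` at height 1.
  continuedFraction≈paths : ∀ a n → continuedFraction a n ≈ paths a 0 n
  continuedFraction≈paths a n = upTo n n ℕ.≤-refl a
    where
    -- Strong induction through the bound `N`; `a` stays quantified because the convolution also
    -- involves `a ∘ suc`.
    upTo : ∀ N n → n ℕ.≤ N → ∀ a → continuedFraction a n ≈ paths a 0 n
    upTo N       zero    _         a = refl
    upTo (suc N) (suc n) (s≤s n≤N) a = begin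
      continuedFraction a (suc n)
        ≈⟨ continuedFraction-suc a n ⟩
      a 0 * (continuedFraction (a ∘ suc) ⊛ continuedFraction a) n
        ≈⟨ *-congˡ (sum-cong-≋ {suc n} λ i → *-cong
             (upTo N (toℕ i) (ℕ.≤-trans (toℕ≤pred[n] i) n≤N) (a ∘ suc))
             (upTo N (n ∸ toℕ i) (ℕ.≤-trans (ℕ.m∸n≤m n (toℕ i)) n≤N) a)) ⟩
      a 0 * (paths (a ∘ suc) 0 ⊛ paths a 0) n
        ≈⟨ *-congˡ (paths-split a 0 n) ⟨
      a 0 * paths a 1 n ∎

  -- Convolution with ballot numbers

  ⊛-scaleʳ : ∀ s F G n → (F ⊛ (λ i → s * G i)) n ≈ s * (F ⊛ G) n
  ⊛-scaleʳ s F G n = trans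
    (sum-cong-≋ {suc n} λ i →
      solve 3 (λ s x y → x :* (s :* y) := s :* (x :* y)) refl s (F (toℕ i)) (G (n ∸ toℕ i)))
    (sym (*-distribˡ-sum s λ (i : Fin (suc n)) → F (toℕ i) * G (n ∸ toℕ i)))

  ⊛-zeroʳ : ∀ F n → (F ⊛ (λ _ → 0#)) n ≈ 0#
  ⊛-zeroʳ F zero    = trans (+-identityʳ _) (zeroʳ _)
  ⊛-zeroʳ F (suc n) = trans (+-cong (zeroʳ _) (⊛-zeroʳ (F ∘ suc) n)) (+-identityˡ 0#)

  -- Grouping both convolutions by the factor `F d` pairs `X (suc i)` with `Y i`. Only the summand
  -- `F (suc n) * X 0` has no partner, hence the hypothesis about it.
  ⊛-exchange : ∀ F X Y X′ Y′ n → (∀ i → X (suc i) + Y i ≈ X′ (suc i) + Y′ i) →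
               F (suc n) * X 0 ≈ F (suc n) * X′ 0 →
               (F ⊛ X) (suc n) + (F ⊛ Y) n ≈ (F ⊛ X′) (suc n) + (F ⊛ Y′) n
  ⊛-exchange F X Y X′ Y′ zero step last = begin
    (F 0 * X 1 + (F 1 * X 0 + 0#)) + (F 0 * Y 0 + 0#)
      ≈⟨ regroup (F 0) (X 1) (Y 0) (F 1 * X 0) ⟩
    F 0 * (X 1 + Y 0) + F 1 * X 0
      ≈⟨ +-cong (*-congˡ (step 0)) last ⟩
    F 0 * (X′ 1 + Y′ 0) + F 1 * X′ 0
      ≈⟨ regroup (F 0) (X′ 1) (Y′ 0) (F 1 * X′ 0) ⟨
    (F 0 * X′ 1 + (F 1 * X′ 0 + 0#)) + (F 0 * Y′ 0 + 0#) ∎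
    where
    regroup = solve 4 (λ f x y t → (f :* x :+ (t :+ con (ℤ.+ 0))) :+ (f :* y :+ con (ℤ.+ 0))
                                   := f :* (x :+ y) :+ t) refl
  ⊛-exchange F X Y X′ Y′ (suc n) step last = begin
    (F 0 * X (suc (suc n)) + ((F ∘ suc) ⊛ X) (suc n)) + (F 0 * Y (suc n) + ((F ∘ suc) ⊛ Y) n)
      ≈⟨ regroup (F 0) (X (suc (suc n))) (Y (suc n)) _ _ ⟩
    F 0 * (X (suc (suc n)) + Y (suc n)) + (((F ∘ suc) ⊛ X) (suc n) + ((F ∘ suc) ⊛ Y) n)
      ≈⟨ +-cong (*-congˡ (step (suc n))) (⊛-exchange (F ∘ suc) X Y X′ Y′ n step last) ⟩
    F 0 * (X′ (suc (suc n)) + Y′ (suc n)) + (((F ∘ suc) ⊛ X′) (suc n) + ((F ∘ suc) ⊛ Y′) n)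
      ≈⟨ regroup (F 0) (X′ (suc (suc n))) (Y′ (suc n)) _ _ ⟨
    (F 0 * X′ (suc (suc n)) + ((F ∘ suc) ⊛ X′) (suc n)) + (F 0 * Y′ (suc n) + ((F ∘ suc) ⊛ Y′) n) ∎
    where
    regroup = solve 5 (λ f x y s t → (f :* x :+ s) :+ (f :* y :+ t) := f :* (x :+ y) :+ (s :+ t)) refl

  -- The coefficient of the Chebyshev polynomial U_{m-2d}(x/2) in xᵐ.
  ballot : ℕ → ℕ → Carrier
  ballot m d = binom m (ℤ.+ d) × 1# - binom m (ℤ.+ d ℤ.- ℤ.+ 1) × 1#

  ballot-zero : ∀ m → ballot m 0 ≈ 1#
  ballot-zero m = begin
    (m C 0) × 1# - 0#  ≡⟨ ≡.cong (λ k → k × 1# - 0#) (nC0≡1 m) ⟩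
    (1# + 0#) - 0#     ≈⟨ solve 0 ((:1 :+ con (ℤ.+ 0)) :- con (ℤ.+ 0) := :1) refl ⟩
    1#                 ∎
    where
    nC0≡1 : ∀ m → m C 0 ≡ 1
    nC0≡1 m = ≡.trans (nCk≡nC[n∸k] {0} {m} ℕ.z≤n) (nCn≡1 m)

  binom-pascal : ∀ m d → binom (suc m) (ℤ.+ suc d) × 1# ≈ binom m (ℤ.+ d) × 1# + binom m (ℤ.+ suc d) × 1#
  binom-pascal m d = trans (×-congˡ (≡.sym (nCk+nC[k+1]≡[n+1]C[k+1] m d)))
                           (×-homo-+ 1# (m C d) (m C suc d))

  ballot-pascal : ∀ m d → ballot (suc m) (suc d) ≈ ballot m (suc d) + ballot m d
  ballot-pascal m zero    = begin
    binom (suc m) (ℤ.+ 1) × 1# - b (suc m) 0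
      ≈⟨ +-cong (binom-pascal m 0) refl ⟩
    (b m 0 + b m 1) - b (suc m) 0
      ≈⟨ solve 3 (λ x y z → (x :+ y) :- z := (y :- x) :+ ((x :- con (ℤ.+ 0)) :+ (x :- z))) refl (b m 0) (b m 1) (b (suc m) 0) ⟩
    (b m 1 - b m 0) + ((b m 0 - 0#) + (b m 0 - b (suc m) 0))
      ≈⟨ +-congˡ (+-congˡ (trans
           (solve 2 (λ x z → x :- z := (x :- con (ℤ.+ 0)) :- (z :- con (ℤ.+ 0))) refl (b m 0) (b (suc m) 0))
           (trans (+-cong (ballot-zero m) (-‿cong (ballot-zero (suc m)))) (-‿inverseʳ 1#)))) ⟩
    (b m 1 - b m 0) + ((b m 0 - 0#) + 0#)
      ≈⟨ +-congˡ (+-identityʳ _) ⟩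
    (b m 1 - b m 0) + (b m 0 - 0#) ∎
    where
    b : ℕ → ℕ → Carrier
    b m d = (m C d) × 1#
  ballot-pascal m (suc d) = trans
    (+-cong (binom-pascal m (suc d)) (-‿cong (binom-pascal m d)))
    (solve 3 (λ x y z → (y :+ z) :- (x :+ y) := (z :- y) :+ (y :- x)) refl
      (binom m (ℤ.+ d) × 1#) (binom m (ℤ.+ suc d) × 1#) (binom m (ℤ.+ suc (suc d)) × 1#))

  -- The two middle entries of an odd row of Pascal's triangle are equal.
  ballot-centre : ∀ n → ballot (suc (2 ℕ.* n)) (suc n) ≈ 0#
  ballot-centre n = begin
    (suc (2 ℕ.* n) C suc n) × 1# - (suc (2 ℕ.* n) C n) × 1#
      ≈⟨ +-congʳ (×-congˡ (≡.trans (nCk≡nC[n∸k] (s≤s (ℕ.m≤m+n n _)))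
           (≡.cong (suc (2 ℕ.* n) C_) (≡.trans (ℕ.m+n∸m≡n n (n ℕ.+ 0)) (ℕ.+-identityʳ n))))) ⟩
    (suc (2 ℕ.* n) C n) × 1# - (suc (2 ℕ.* n) C n) × 1#
      ≈⟨ -‿inverseʳ _ ⟩
    0# ∎

  -- By Pascal's rule the generating function of `ballot (suc m)` is 1 + z times that of `ballot m`.
  ballot-⊛ : ∀ m X n → (ballot (suc m) ⊛ X) (suc n) ≈ (ballot m ⊛ X) (suc n) + (ballot m ⊛ X) n
  ballot-⊛ m X n = begin
    ballot (suc m) 0 * X (suc n) + ((ballot (suc m) ∘ suc) ⊛ X) n
      ≈⟨ +-cong (*-congʳ (trans (ballot-zero (suc m)) (sym (ballot-zero m))))
                (⊛-cong {G = X} n (ballot-pascal m) (λ _ → refl)) ⟩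
    ballot m 0 * X (suc n) + ((λ d → ballot m (suc d) + ballot m d) ⊛ X) n
      ≈⟨ +-congˡ (⊛-distribʳ (ballot m ∘ suc) (ballot m) X n) ⟩
    ballot m 0 * X (suc n) + (((ballot m ∘ suc) ⊛ X) n + (ballot m ⊛ X) n)
      ≈⟨ +-assoc _ _ _ ⟨
    (ballot m 0 * X (suc n) + ((ballot m ∘ suc) ⊛ X) n) + (ballot m ⊛ X) n ∎

  -- The hypotheses say that N j i is the coefficient of P_j in U_{j+2i}(x/2), where
  -- P₀ = 1 and x P_j = P_{j+1} + a_{j-1} P_{j-1}.
  paths-ballot : ∀ (a : ℕ → Carrier) (N : ℕ → ℕ → Carrier) → (∀ j → N j 0 ≈ 1#) →
    (∀ i → N 0 (suc i) + N 0 i ≈ a 0 * N 1 i) →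
    (∀ j i → N (suc j) (suc i) + N (suc j) i ≈ N j (suc i) + a (suc j) * N (suc (suc j)) i) →
    ∀ j n → paths a j n ≈ (ballot (2 ℕ.* n ℕ.+ j) ⊛ N j) n
  paths-ballot a N N-0 N-bottom N-step = expand
    where
    expand : ∀ j n → paths a j n ≈ (ballot (2 ℕ.* n ℕ.+ j) ⊛ N j) n
    expand j       zero    = sym (begin
      ballot j 0 * N j 0 + 0#  ≈⟨ +-identityʳ _ ⟩
      ballot j 0 * N j 0       ≈⟨ *-cong (ballot-zero j) (N-0 j) ⟩
      1# * 1#                  ≈⟨ *-identityˡ 1# ⟩
      1#                       ∎)
    expand zero    (suc n) = sym (begin
      (ballot (2 ℕ.* suc n ℕ.+ 0) ⊛ N 0) (suc n)
        ≡⟨ ≡.cong (λ k → (ballot k ⊛ N 0) (suc n)) (index n) ⟩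
      (ballot (suc (suc (2 ℕ.* n))) ⊛ N 0) (suc n)
        ≈⟨ ballot-⊛ m (N 0) n ⟩
      (ballot m ⊛ N 0) (suc n) + (ballot m ⊛ N 0) n
        -- The zero series stands for the missing coefficients at height -1, and `ballot-centre`
        -- makes the unpaired summand vanish.
        ≈⟨ ⊛-exchange (ballot m) (N 0) (N 0) (λ _ → 0#) (λ i → a 0 * N 1 i) n
             (λ i → trans (N-bottom i) (sym (+-identityˡ _)))
             (trans (*-congʳ (ballot-centre n)) (trans (zeroˡ _) (sym (zeroʳ _)))) ⟩
      (ballot m ⊛ (λ _ → 0#)) (suc n) + (ballot m ⊛ (λ i → a 0 * N 1 i)) n
        ≈⟨ +-cong (⊛-zeroʳ (ballot m) (suc n)) (⊛-scaleʳ (a 0) (ballot m) (N 1) n) ⟩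
      0# + a 0 * (ballot m ⊛ N 1) n
        ≈⟨ +-identityˡ _ ⟩
      a 0 * (ballot m ⊛ N 1) n
        ≡⟨ ≡.cong (λ k → a 0 * (ballot k ⊛ N 1) n) (ℕ.+-comm 1 (2 ℕ.* n)) ⟩
      a 0 * (ballot (2 ℕ.* n ℕ.+ 1) ⊛ N 1) n
        ≈⟨ *-congˡ (expand 1 n) ⟨
      a 0 * paths a 1 n ∎)
      where
      m = suc (2 ℕ.* n)
      index : ∀ n → 2 ℕ.* suc n ℕ.+ 0 ≡ suc (suc (2 ℕ.* n))
      index n = ≡.trans (ℕ.+-identityʳ _) (ℕ.*-suc 2 n)
    expand (suc j) (suc n) = sym (begin
      (ballot (2 ℕ.* suc n ℕ.+ suc j) ⊛ N (suc j)) (suc n)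
        ≡⟨ ≡.cong (λ k → (ballot k ⊛ N (suc j)) (suc n)) (ℕ.+-suc (2 ℕ.* suc n) j) ⟩
      (ballot (suc m) ⊛ N (suc j)) (suc n)
        ≈⟨ ballot-⊛ m (N (suc j)) n ⟩
      (ballot m ⊛ N (suc j)) (suc n) + (ballot m ⊛ N (suc j)) n
        -- At positive height the unpaired summands agree, since `N (suc j) 0` and `N j 0` are both
        -- 1.
        ≈⟨ ⊛-exchange (ballot m) (N (suc j)) (N (suc j)) (N j) (λ i → a (suc j) * N (suc (suc j)) i) n
             (N-step j) (*-congˡ (trans (N-0 (suc j)) (sym (N-0 j)))) ⟩
      (ballot m ⊛ N j) (suc n) + (ballot m ⊛ (λ i → a (suc j) * N (suc (suc j)) i)) n
        ≈⟨ +-congˡ (⊛-scaleʳ (a (suc j)) (ballot m) (N (suc (suc j))) n) ⟩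
      (ballot m ⊛ N j) (suc n) + a (suc j) * (ballot m ⊛ N (suc (suc j))) n
        ≡⟨ ≡.cong (λ k → (ballot m ⊛ N j) (suc n) + a (suc j) * (ballot k ⊛ N (suc (suc j))) n) (2[1+n]+j≡2n+[2+j] n j) ⟩
      (ballot m ⊛ N j) (suc n) + a (suc j) * (ballot (2 ℕ.* n ℕ.+ suc (suc j)) ⊛ N (suc (suc j))) n
        ≈⟨ +-cong (expand j (suc n)) (*-congˡ (expand (suc (suc j)) n)) ⟨
      paths a j (suc n) + a (suc j) * paths a (suc (suc j)) n ∎)
      where
      m = 2 ℕ.* suc n ℕ.+ j

-- Gaussian binomials and their two Pascal rules

module Connection {c ℓ} (R : CommutativeRing c ℓ) (q : CommutativeRing.Carrier R) where

  open CommutativeRing R hiding (zero)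
  open Algebra.Properties.Semiring.Exp semiring using (^-homo-*; ^-congʳ)
  open Algebra.Properties.CommutativeSemiring.Exp commutativeSemiring using (^-distrib-*)
  open Relation.Binary.Reasoning.Setoid setoid
  open Euler R
  open IntegerCoefficients R

  -- The Gaussian binomial coefficient (i + j choose i) in base Q.
  gauss : Carrier → ℕ → ℕ → Carrier
  gauss Q j       zero    = 1#
  gauss Q zero    (suc i) = 1#
  gauss Q (suc j) (suc i) = gauss Q (suc j) i + Q ^ suc i * gauss Q j (suc i)

  -- Both sides are (1 - Q) [i+j+1]! / ([i]! [j]!) in Q-factorials. As these need not be invertible
  -- in the ring, the proof is an induction along the Pascal recurrence.
  gauss-absorb : ∀ Q j i →
    (1# - Q ^ suc i) * gauss Q j (suc i) ≈ (1# - Q ^ suc j) * gauss Q (suc j) i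
  gauss-absorb Q zero    zero    = refl
  gauss-absorb Q zero    (suc i) = begin
    (1# - Q * Q ^ suc i) * 1#
      ≈⟨ solve 2 (λ x y → (:1 :- x :* y) :* :1 := (:1 :- y) :* :1 :+ (:1 :- x :* :1) :* (y :* :1)) refl Q (Q ^ suc i) ⟩
    (1# - Q ^ suc i) * 1# + (1# - Q * 1#) * (Q ^ suc i * 1#)
      ≈⟨ +-congʳ (gauss-absorb Q zero i) ⟩
    (1# - Q * 1#) * gauss Q 1 i + (1# - Q * 1#) * (Q ^ suc i * 1#)
      ≈⟨ distribˡ _ _ _ ⟨
    (1# - Q * 1#) * (gauss Q 1 i + Q ^ suc i * 1#) ∎
  gauss-absorb Q (suc j) zero    = begin
    (1# - Q * 1#) * (1# + (Q * 1#) * gauss Q j 1)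
      ≈⟨ solve 2 (λ x g → (:1 :- x :* :1) :* (:1 :+ x :* :1 :* g) := (:1 :- x) :+ x :* ((:1 :- x :* :1) :* g)) refl Q (gauss Q j 1) ⟩
    (1# - Q) + Q * ((1# - Q * 1#) * gauss Q j 1)
      ≈⟨ +-congˡ (*-congˡ (gauss-absorb Q j zero)) ⟩
    (1# - Q) + Q * ((1# - Q ^ suc j) * 1#)
      ≈⟨ solve 2 (λ x y → (:1 :- x) :+ x :* ((:1 :- y) :* :1) := (:1 :- x :* y) :* :1) refl Q (Q ^ suc j) ⟩
    (1# - Q * Q ^ suc j) * 1# ∎
  gauss-absorb Q (suc j) (suc i) = begin
    (1# - Q * u) * (g + (Q * u) * h)
      ≈⟨ solve 4 (λ x u g h → (:1 :- x :* u) :* (g :+ (x :* u) :* h)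
           := (:1 :- x :* u) :* g :+ (x :* u) :* ((:1 :- x :* u) :* h)) refl Q u g h ⟩
    (1# - Q * u) * g + (Q * u) * ((1# - Q * u) * h)
      ≈⟨ +-congˡ (*-congˡ (gauss-absorb Q j (suc i))) ⟩
    (1# - Q * u) * g + (Q * u) * ((1# - v) * g)
      ≈⟨ solve 4 (λ x u v g → (:1 :- x :* u) :* g :+ (x :* u) :* ((:1 :- v) :* g)
           := (:1 :- u) :* g :+ (:1 :- x :* v) :* (u :* g)) refl Q u v g ⟩
    (1# - u) * g + (1# - Q * v) * (u * g)
      ≈⟨ +-congʳ (gauss-absorb Q (suc j) i) ⟩
    (1# - Q * v) * k + (1# - Q * v) * (u * g)
      ≈⟨ distribˡ _ _ _ ⟨
    (1# - Q * v) * (k + u * g) ∎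
    where
    u = Q ^ suc i
    v = Q ^ suc j
    g = gauss Q (suc j) (suc i)
    h = gauss Q j (suc (suc i))
    k = gauss Q (suc (suc j)) i

  -- The q-Pascal rule with the power on the other summand; it differs from the defining rule by
  -- exactly the two sides of `gauss-absorb`.
  gauss-pascal : ∀ Q j i → gauss Q (suc j) (suc i) ≈ Q ^ suc j * gauss Q (suc j) i + gauss Q j (suc i)
  gauss-pascal Q j i = begin
    k + u * h
      ≈⟨ solve 4 (λ u v k h → k :+ u :* h := (v :* k :+ h) :+ ((:1 :- v) :* k :- (:1 :- u) :* h)) refl u v k h ⟩
    (v * k + h) + ((1# - v) * k - (1# - u) * h)
      ≈⟨ +-congˡ (trans (+-congʳ (sym (gauss-absorb Q j i))) (-‿inverseʳ _)) ⟩
    (v * k + h) + 0#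
      ≈⟨ +-identityʳ _ ⟩
    v * k + h ∎
    where
    u = Q ^ suc i
    v = Q ^ suc j
    k = gauss Q (suc j) i
    h = gauss Q j (suc i)

  G : ℕ → ℕ → Carrier
  G = gauss (q * q)

  -- Powers of `q * q` become products of powers of `q`, so that the later ring identities involve
  -- powers of `q` only.
  G-absorb : ∀ j i → (1# - q ^ suc i * q ^ suc i) * G j (suc i)
                   ≈ (1# - q ^ suc j * q ^ suc j) * G (suc j) i
  G-absorb j i = begin
    (1# - q ^ suc i * q ^ suc i) * G j (suc i)  ≈⟨ *-congʳ (+-congˡ (-‿cong (^-distrib-* q q (suc i)))) ⟨
    (1# - (q * q) ^ suc i) * G j (suc i)        ≈⟨ gauss-absorb (q * q) j i ⟩
    (1# - (q * q) ^ suc j) * G (suc j) i        ≈⟨ *-congʳ (+-congˡ (-‿cong (^-distrib-* q q (suc j)))) ⟩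
    (1# - q ^ suc j * q ^ suc j) * G (suc j) i  ∎

  G-suc : ∀ j i → G (suc j) (suc i) ≈ G (suc j) i + (q ^ suc i * q ^ suc i) * G j (suc i)
  G-suc j i = +-congˡ (*-congʳ (^-distrib-* q q (suc i)))

  G-pascal : ∀ j i → G (suc j) (suc i) ≈ (q ^ suc j * q ^ suc j) * G (suc j) i + G j (suc i)
  G-pascal j i = trans (gauss-pascal (q * q) j i) (+-congʳ (*-congʳ (^-distrib-* q q (suc j))))

  -- Closed form of the connection coefficients

  weight : ℕ → Carrier
  weight j = (1# - q ^ suc j) * (1# + q * q ^ suc j)

  -- The polynomial form of G j i * (1 + q^(j+2i+1)) / (1 + q^(j+1)).
  A : ℕ → ℕ → Carrier
  A j zero    = 1#
  A j (suc i) = G j (suc i) - q ^ suc j * (1# - q ^ suc j) * G (suc j) i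

  -- The factor 1 + q^(j+2) of `weight j` cancels the denominator of the closed form of
  -- `A (suc j) i`.
  weight*A : ∀ j i → weight j * A (suc j) i ≈
             (1# - q ^ suc j) * (1# + q * q ^ suc j * (q ^ i * q ^ i)) * G (suc j) i
  weight*A j zero    = solve 2 (λ q x → (:1 :- x) :* (:1 :+ q :* x) :* :1
    := (:1 :- x) :* (:1 :+ q :* x :* (:1 :* :1)) :* :1) refl q (q ^ suc j)
  weight*A j (suc i) = begin
    (1# - x) * (1# + q * x) * (g - q * x * (1# - q * x) * h)
      ≈⟨ solve 4 (λ q x g h → (:1 :- x) :* (:1 :+ q :* x) :* (g :- q :* x :* (:1 :- q :* x) :* h)
           := (:1 :- x) :* ((:1 :+ q :* x) :* g :- q :* x :* ((:1 :- (q :* x) :* (q :* x)) :* h)))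
           refl q x g h ⟩
    (1# - x) * ((1# + q * x) * g - q * x * ((1# - (q * x) * (q * x)) * h))
      -- The shape of `A` is chosen for this: 1 + q x y² = (1 + q x) - q x (1 - y²), and `G-absorb`
      -- turns (1 - y²) g into a multiple of 1 + q x.
      ≈⟨ *-congˡ (+-congˡ (-‿cong (*-congˡ (sym (G-absorb (suc j) i))))) ⟩
    (1# - x) * ((1# + q * x) * g - q * x * ((1# - y * y) * g))
      ≈⟨ solve 4 (λ q x y g → (:1 :- x) :* ((:1 :+ q :* x) :* g :- q :* x :* ((:1 :- y :* y) :* g))
           := (:1 :- x) :* (:1 :+ q :* x :* (y :* y)) :* g) refl q x y g ⟩
    (1# - x) * (1# + q * x * (y * y)) * g ∎
    where
    x = q ^ suc j
    y = q ^ suc i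
    g = G (suc j) (suc i)
    h = G (suc (suc j)) i

  -- The increment A j (i+1) - A (j-1) (i+1), where A (-1) = 0.
  B : ℕ → ℕ → Carrier
  B j i = q ^ j * (G j i - q * (1# - q ^ suc j) * G (suc j) i)

  A-zero-suc : ∀ i → A 0 (suc i) ≈ B 0 i
  A-zero-suc i = begin
    1# - q * 1# * (1# - q * 1#) * G 1 i
      ≈⟨ solve 2 (λ q g → :1 :- q :* :1 :* (:1 :- q :* :1) :* g := :1 :* (:1 :- q :* (:1 :- q :* :1) :* g)) refl q (G 1 i) ⟩
    1# * (1# - q * (1# - q * 1#) * G 1 i)
      ≈⟨ *-congˡ (+-congʳ (G-zero i)) ⟨
    B 0 i ∎
    where
    G-zero : ∀ i → G 0 i ≈ 1#
    G-zero zero    = refl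
    G-zero (suc i) = refl

  -- `G-pascal` splits off the leading term of `A j (suc i)`; what remains regroups into
  -- `B (suc j) i`.
  A-suc-suc : ∀ j i → A (suc j) (suc i) ≈ A j (suc i) + B (suc j) i
  A-suc-suc j i = begin
    G (suc j) (suc i) - q * x * (1# - q * x) * h
      ≈⟨ +-congʳ (G-pascal j i) ⟩
    ((x * x) * k + g) - q * x * (1# - q * x) * h
      ≈⟨ solve 5 (λ q x g h k → ((x :* x) :* k :+ g) :- q :* x :* (:1 :- q :* x) :* h
           := (g :- x :* (:1 :- x) :* k) :+ x :* (k :- q :* (:1 :- q :* x) :* h)) refl q x g h k ⟩
    (g - x * (1# - x) * k) + x * (k - q * (1# - q * x) * h) ∎
    where
    x = q ^ suc j
    g = G j (suc i)
    h = G (suc (suc j)) i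
    k = G (suc j) i

  -- The recurrence for `N` after removing the common factor (-1)^i q^(i²): the next exponent is
  -- larger by 2i + 1, which gives the power of q in front of the increment `B j i`.
  A-step : ∀ j i → A j i ≈ weight j * A (suc j) i + q * (q ^ i * q ^ i) * B j i
  A-step j zero    = solve 2 (λ q z → :1 := (:1 :- q :* z) :* (:1 :+ q :* (q :* z)) :* :1
    :+ q :* (:1 :* :1) :* (z :* (:1 :- q :* (:1 :- q :* z) :* :1))) refl q (q ^ j)
  A-step j (suc i) = begin
    g - q * z * (1# - q * z) * h
      -- Once `G-suc` has expanded `G (suc j) (suc i)`, the two sides differ by the last summand,
      -- which vanishes by `G-absorb`.
      ≈⟨ solve 5 (λ q z y g h → g :- q :* z :* (:1 :- q :* z) :* h
           := ((:1 :- q :* z) :* (:1 :+ q :* (q :* z) :* (y :* y)) :* (h :+ (y :* y) :* g)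
               :+ q :* (y :* y) :* (z :* (g :- q :* (:1 :- q :* z) :* (h :+ (y :* y) :* g))))
              :+ ((:1 :- y :* y) :* g :- (:1 :- (q :* z) :* (q :* z)) :* h)) refl q z y g h ⟩
    ((1# - q * z) * (1# + q * (q * z) * (y * y)) * (h + (y * y) * g)
      + q * (y * y) * (z * (g - q * (1# - q * z) * (h + (y * y) * g))))
      + ((1# - y * y) * g - (1# - (q * z) * (q * z)) * h)
      ≈⟨ +-cong
           (+-cong (*-congˡ (G-suc j i)) (*-congˡ (*-congˡ (+-congˡ (-‿cong (*-congˡ (G-suc j i)))))))
           (trans (sym (-‿inverseʳ _)) (+-congˡ (-‿cong (G-absorb j i)))) ⟨
    ((1# - q * z) * (1# + q * (q * z) * (y * y)) * G (suc j) (suc i) + q * (y * y) * B j (suc i)) + 0#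
      ≈⟨ +-identityʳ _ ⟩
    (1# - q * z) * (1# + q * (q * z) * (y * y)) * G (suc j) (suc i) + q * (y * y) * B j (suc i)
      ≈⟨ +-congʳ (weight*A j (suc i)) ⟨
    weight j * A (suc j) (suc i) + q * (y * y) * B j (suc i) ∎
    where
    z = q ^ j
    y = q ^ suc i
    g = G j (suc i)
    h = G (suc j) i

  -- The coefficient of P_j in U_{j+2i}(x/2).
  N : ℕ → ℕ → Carrier
  N j i = (- 1#) ^ i * q ^ (i ℕ.^ 2) * A j i

  q^[1+i]² : ∀ i → q ^ (suc i ℕ.^ 2) ≈ q ^ (i ℕ.^ 2) * (q * (q ^ i * q ^ i))
  q^[1+i]² i = begin
    q ^ (suc i ℕ.^ 2)                     ≈⟨ ^-congʳ q ([1+i]²≡i²+[1+2i] i) ⟩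
    q ^ (i ℕ.^ 2 ℕ.+ suc (i ℕ.+ i))       ≈⟨ ^-homo-* q (i ℕ.^ 2) (suc (i ℕ.+ i)) ⟩
    q ^ (i ℕ.^ 2) * (q * q ^ (i ℕ.+ i))   ≈⟨ *-congˡ (*-congˡ (^-homo-* q i i)) ⟩
    q ^ (i ℕ.^ 2) * (q * (q ^ i * q ^ i)) ∎

  N-zero : ∀ j → N j 0 ≈ 1#
  N-zero j = solve 0 (:1 :* :1 :* :1 := :1) refl

  N-suc : ∀ j i → N j (suc i) ≈ - ((- 1#) ^ i * q ^ (i ℕ.^ 2) * (q * (q ^ i * q ^ i) * A j (suc i)))
  N-suc j i = trans (*-congʳ (*-congˡ (q^[1+i]² i)))
    (solve 4 (λ e s t a → (:- :1) :* e :* (s :* t) :* a := :- (e :* s :* (t :* a))) refl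
      ((- 1#) ^ i) (q ^ (i ℕ.^ 2)) (q * (q ^ i * q ^ i)) (A j (suc i)))

  -- Compares the coefficients of P_0 in U_{2i+2} + U_{2i} = x U_{2i+1}, all at x/2: on the right
  -- only x P_1 contributes, with factor w_0.
  N-bottom : ∀ i → N 0 (suc i) + N 0 i ≈ weight 0 * N 1 i
  N-bottom i = begin
    N 0 (suc i) + s * A 0 i
      ≈⟨ +-cong (trans (N-suc 0 i) (-‿cong (*-congˡ (*-congˡ (A-zero-suc i))))) (*-congˡ (A-step 0 i)) ⟩
    - (s * (t * B 0 i)) + s * (weight 0 * A 1 i + t * B 0 i)
      ≈⟨ solve 5 (λ s t b w a → :- (s :* (t :* b)) :+ s :* (w :* a :+ t :* b) := w :* (s :* a))
           refl s t (B 0 i) (weight 0) (A 1 i) ⟩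
    weight 0 * (s * A 1 i) ∎
    where
    s = (- 1#) ^ i * q ^ (i ℕ.^ 2)
    t = q * (q ^ i * q ^ i)

  -- Likewise for P_{j+1} in U_{j+2i+3} + U_{j+2i+1} = x U_{j+2i+2}, where x P_j and x P_{j+2}
  -- contribute.
  N-step : ∀ j i → N (suc j) (suc i) + N (suc j) i ≈ N j (suc i) + weight (suc j) * N (suc (suc j)) i
  N-step j i = begin
    N (suc j) (suc i) + s * A (suc j) i
      ≈⟨ +-cong (trans (N-suc (suc j) i) (-‿cong (*-congˡ (*-congˡ (A-suc-suc j i))))) (*-congˡ (A-step (suc j) i)) ⟩
    - (s * (t * (A j (suc i) + b))) + s * (w * A (suc (suc j)) i + t * b)
      ≈⟨ solve 6 (λ s t b w a a′ → :- (s :* (t :* (a′ :+ b))) :+ s :* (w :* a :+ t :* b)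
           := :- (s :* (t :* a′)) :+ w :* (s :* a)) refl s t b w (A (suc (suc j)) i) (A j (suc i)) ⟩
    - (s * (t * A j (suc i))) + w * (s * A (suc (suc j)) i)
      ≈⟨ +-congʳ (N-suc j i) ⟨
    N j (suc i) + w * N (suc (suc j)) i ∎
    where
    s = (- 1#) ^ i * q ^ (i ℕ.^ 2)
    t = q * (q ^ i * q ^ i)
    w = weight (suc j)
    b = B (suc j) i

  -- At j = 0 the Gaussian binomial is 1, and the closed form is (1 + q^(2i+1)) / (1 + q).
  [1+q]*A : ∀ i → A 0 i * (1# + q) ≈ 1# + q * (q ^ i * q ^ i)
  [1+q]*A zero    = solve 1 (λ q → :1 :* (:1 :+ q) := :1 :+ q :* (:1 :* :1)) refl q
  [1+q]*A (suc i) = begin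
    (1# - q * 1# * (1# - q * 1#) * G 1 i) * (1# + q)
      ≈⟨ solve 2 (λ q g → (:1 :- q :* :1 :* (:1 :- q :* :1) :* g) :* (:1 :+ q)
           := :1 :+ q :- q :* ((:1 :- (q :* :1) :* (q :* :1)) :* g)) refl q (G 1 i) ⟩
    1# + q - q * ((1# - (q * 1#) * (q * 1#)) * G 1 i)
      ≈⟨ +-congˡ (-‿cong (*-congˡ (sym (G-absorb 0 i)))) ⟩
    1# + q - q * ((1# - y * y) * 1#)
      ≈⟨ solve 2 (λ q y → :1 :+ q :- q :* ((:1 :- y :* y) :* :1) := :1 :+ q :* (y :* y)) refl q y ⟩
    1# + q * (y * y) ∎
    where
    y = q ^ suc i

  N-at-0 : ⦃ _ : Invertible (1# + q) ⦄ → ∀ k →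
           N 0 k ≈ (- 1#) ^ k * ((q ^ (k ℕ.^ 2) + q ^ (suc k ℕ.^ 2)) / (1# + q))
  N-at-0 ⦃ r , _ , [1+q]*r≈1 ⦄ k = begin
    e * s * a
      ≈⟨ *-identityʳ _ ⟨
    e * s * a * 1#
      ≈⟨ *-congˡ [1+q]*r≈1 ⟨
    e * s * a * ((1# + q) * r)
      ≈⟨ solve 5 (λ e s a p r → e :* s :* a :* (p :* r) := e :* (s :* (a :* p) :* r)) refl e s a (1# + q) r ⟩
    e * (s * (a * (1# + q)) * r)
      ≈⟨ *-congˡ (*-congʳ (*-congˡ ([1+q]*A k))) ⟩
    e * (s * (1# + q * (q ^ k * q ^ k)) * r)
      -- The two powers in the numerator arise from k² + (2k + 1) = (k + 1)².
      ≈⟨ *-congˡ (*-congʳ (trans (distribˡ _ _ _) (+-cong (*-identityʳ s) (sym (q^[1+i]² k))))) ⟩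
    e * ((s + q ^ (suc k ℕ.^ 2)) * r) ∎
    where
    e = (- 1#) ^ k
    s = q ^ (k ℕ.^ 2)
    a = A 0 k

-- Assembling the formula for E_n(-q, q)

proposition5p9 :
    ∀ {c ℓ} (R : CommutativeRing c ℓ) →
    let open CommutativeRing R
        open Euler R
    in
    (q : Carrier) ⦃ 1-q⁻¹ : Invertible (1# - q) ⦄ ⦃ 1+q⁻¹ : Invertible (1# + q) ⦄ →
    (n : ℕ) →
    E n (- q) q ≈
      (1# / (1# - q)) ^ (2 ℕ.* n) *
      ∑₀ n (λ k →
        (binom (2 ℕ.* n) (ℤ.+ n ℤ.- ℤ.+ k) × 1# - binom (2 ℕ.* n) (ℤ.+ n ℤ.- ℤ.+ k ℤ.- ℤ.+ 1) × 1#)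
        * (- 1#) ^ k
        * ((q ^ (k ℕ.^ 2) + q ^ (suc k ℕ.^ 2)) / (1# + q)))
proposition5p9 R q ⦃ 1-q⁻¹ ⦄ n = begin
  E n (- q) q
    ≈⟨ continuedFraction≈paths (λ i → qInt q (suc i) * tqInt (- q) q (suc i)) n ⟩
  paths (λ i → qInt q (suc i) * tqInt (- q) q (suc i)) 0 n
    -- Each partial coefficient has two denominators 1 - q, and t = -q turns 1 - t q^m into 1 + q
    -- q^m.
    ≈⟨ paths-scale weight _ (r ^ 2) scale 0 n ⟩
  (r ^ 2) ^ n * paths weight 0 n
    ≈⟨ *-cong (^-assocʳ r 2 n) (paths-ballot weight N N-zero N-bottom N-step 0 n) ⟩
  r ^ (2 ℕ.* n) * (ballot (2 ℕ.* n ℕ.+ 0) ⊛ N 0) n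
    ≈⟨ *-congˡ (⊛-reverse (ballot (2 ℕ.* n ℕ.+ 0)) (N 0) n) ⟩
  r ^ (2 ℕ.* n) * ∑₀ n (λ k → ballot (2 ℕ.* n ℕ.+ 0) (n ∸ k) * N 0 k)
    -- The bound on the summation index makes the truncated `n ∸ k` equal to the integer n - k.
    ≈⟨ *-congˡ (sum-cong-≋ {suc n} λ i → term (toℕ i) (toℕ≤pred[n] i)) ⟩
  r ^ (2 ℕ.* n) * ∑₀ n (λ k →
        (binom (2 ℕ.* n) (ℤ.+ n ℤ.- ℤ.+ k) × 1# - binom (2 ℕ.* n) (ℤ.+ n ℤ.- ℤ.+ k ℤ.- ℤ.+ 1) × 1#)
        * (- 1#) ^ k
        * ((q ^ (k ℕ.^ 2) + q ^ (suc k ℕ.^ 2)) / (1# + q))) ∎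
  where
  open CommutativeRing R hiding (zero)
  open Euler R
  open IntegerCoefficients R
  open Paths R
  open Connection R q
  open Algebra.Properties.Semiring.Exp semiring using (^-assocʳ)
  open Algebra.Properties.Semiring.Sum semiring using (sum-cong-≋)
  open Relation.Binary.Reasoning.Setoid setoid

  r : Carrier
  r = 1# / (1# - q)

  scale : ∀ i → qInt q (suc i) * tqInt (- q) q (suc i) ≈ r ^ 2 * weight i
  scale i = solve 3 (λ q x s → (:1 :- x) :* s :* ((:1 :- (:- q) :* x) :* s)
      := (:1 :* s) :* ((:1 :* s) :* :1) :* ((:1 :- x) :* (:1 :+ q :* x)))
    refl q (q ^ suc i) (proj₁ 1-q⁻¹)

  term : ∀ k → k ℕ.≤ n → ballot (2 ℕ.* n ℕ.+ 0) (n ∸ k) * N 0 k ≈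
    (binom (2 ℕ.* n) (ℤ.+ n ℤ.- ℤ.+ k) × 1# - binom (2 ℕ.* n) (ℤ.+ n ℤ.- ℤ.+ k ℤ.- ℤ.+ 1) × 1#)
    * (- 1#) ^ k
    * ((q ^ (k ℕ.^ 2) + q ^ (suc k ℕ.^ 2)) / (1# + q))
  term k k≤n = trans
    (*-cong
      (reflexive (≡.cong₂ (λ m d → binom m d × 1# - binom m (d ℤ.- ℤ.+ 1) × 1#)
        (ℕ.+-identityʳ (2 ℕ.* n))
        (≡.sym (≡.trans (ℤ.m-n≡m⊖n n k) (ℤ.⊖-≥ k≤n)))))
      (N-at-0 k))
    (sym (*-assoc _ _ _))
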